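{- Consider the online bipartite matching problem with replacements: a finite set $S$ of servers is given in advance, and clients arrive one at a time, each arriving client $c$ revealing all of its edges to $S$. The SAP protocol maintains a matching as follows: when a client $c$ arrives, if there is an augmenting path (with respect to the current matching) from $c$ to an unmatched server, it augments along a shortest such path (ties broken arbitrarily); otherwise it does nothing. If $n$ clients are added in total, then the SAP protocol makes at most $O(n\log^2 n)$ total replacements (changes to the matching) over the whole sequence of insertions.
   Context: An alternating path alternates between edges not in the matching and edges in the matching; an augmenting path is an alternating path starting and ending at unmatched vertices. Augmenting along a path $P$ means flipping the matched status of every edge of $P$; the number of replacements it causes is proportional to the length of $P$. -}

module Defs where

open import Data.Nat using (ℕ; zero; suc; _+_; _*_; _∸_; _≤_; _<_)
open import Data.Fin using (Fin; toℕ; fromℕ<; _≟_)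
open import Data.Bool using (Bool; true)
open import Data.Maybe using (Maybe; just; nothing)
open import Data.List using (List; []; _∷_; map; length)
open import Data.List.Relation.Unary.All using (All)
open import Data.List.Relation.Unary.Unique.Propositional using (Unique)
open import Data.Product using (Σ; _×_; _,_; proj₁; proj₂; ∃)
open import Data.Sum using (_⊎_)
open import Data.Empty using (⊥)
open import Relation.Nullary using (¬_; yes; no)
open import Relation.Binary.PropositionalEquality using (_≡_)

-- Servers are Fin s (given in advance); clients are Fin n, arriving in the
-- order 0, 1, ..., n-1.  E c a ≡ true means client c has an edge to server a.
Graph : ℕ → ℕ → Set
Graph n s = Fin n → Fin s → Bool

Matching : ℕ → ℕ → Set
Matching n s = Fin s → Maybe (Fin n)

emptyMatching : ∀ {n s} → Matching n s
emptyMatching _ = nothing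

module _ {n s : ℕ} (E : Graph n s) (M : Matching n s) where

  -- Alt c P : P = [(c₀,s₁),(c₁,s₂),…,(c_{k-1},s_k)] encodes the alternating
  -- path c₀ s₁ c₁ s₂ … c_{k-1} s_k starting at client c = c₀ : each
  -- (c_{i-1},s_i) is an edge of E not in M, each (c_i,s_i) (1 ≤ i < k) is an
  -- edge of M, and the final server s_k is unmatched.
  Alt : Fin n → List (Fin n × Fin s) → Set
  Alt c [] = ⊥
  Alt c ((c' , a) ∷ []) =
    c' ≡ c × E c a ≡ true × ¬ (M a ≡ just c) × M a ≡ nothing
  Alt c ((c' , a) ∷ ((c'' , b) ∷ rest)) =
    c' ≡ c × E c a ≡ true × ¬ (M a ≡ just c) × M a ≡ just c''
      × Alt c'' ((c'' , b) ∷ rest)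

  -- An augmenting path from the (unmatched) client c in the graph induced by
  -- the clients that have arrived so far (those with index ≤ t); the path is
  -- simple (no repeated clients or servers).
  AugPath : (t : Fin n) → Fin n → List (Fin n × Fin s) → Set
  AugPath t c P =
    (∀ a → ¬ (M a ≡ just c)) × Alt c P
      × Unique (map proj₁ P) × Unique (map proj₂ P)
      × All (λ e → toℕ (proj₁ e) ≤ toℕ t) P

  pathEdges : List (Fin n × Fin s) → ℕ
  pathEdges P = 2 * length P ∸ 1

-- Augmenting along P: server s_i becomes matched to c_{i-1}, flipping the
-- status of every edge of P.
augment : ∀ {n s} → Matching n s → List (Fin n × Fin s) → Matching n s
augment M [] = M
augment M ((c , a) ∷ rest) b with b ≟ a
... | yes _ = just c
... | no _ = augment M rest b

-- One step of SAP when client t arrives: SAPStep E t M M' k means the SAP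
-- protocol may move from matching M to M' making k replacements (= number of
-- matching edges changed = length of the augmenting path).
SAPStep : ∀ {n s} → Graph n s → Fin n → Matching n s → Matching n s → ℕ → Set
SAPStep E t M M' k =
    ( (¬ Σ _ (λ P → AugPath E M t t P))
      × (∀ a → M' a ≡ M a) × k ≡ 0 )
  ⊎ Σ _ (λ P → AugPath E M t t P
      × (∀ Q → AugPath E M t t Q → length P ≤ length Q)
      × (∀ a → M' a ≡ augment M P a)
      × k ≡ pathEdges E M P)

data SAPRun {n s : ℕ} (E : Graph n s) : ℕ → Matching n s → ℕ → Set where
  start : SAPRun E 0 emptyMatching 0
  step  : ∀ {t M M' k c} → SAPRun E t M k → (t<n : t < n)
        → SAPStep E (fromℕ< t<n) M M' c → SAPRun E (suc t) M' (k + c)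

{-# OPTIONS --safe #-}
module Submission where

-- For m ≥ 1 consider the maximum of (m+1)|K| − m|N(K)| over sets K of matched
-- clients.  By Hall's condition it never exceeds n.  When client t arrives with a
-- shortest augmenting path longer than m(⌊log₂ n⌋ + 2), every neighbour of t lies in
-- N(K) for an optimal K: otherwise, by optimality, the servers outside N(K) reached
-- by alternating paths from such a neighbour multiply by (m+1)/m in each
-- round, exceeding n before the path ends.  Hence t joins K at no cost, the
-- potential rises by m + 1, and at most n / m paths are that long.  Summing over the
-- dyadic values m = 2^j bounds the total length.

open import Defs
open import Data.Bool using (true)
import Data.Bool.Properties as Bool
open import Data.Empty using (⊥)
open import Data.Fin using (Fin; toℕ; fromℕ<; _≟_)
open import Data.Fin.Properties using (toℕ-fromℕ<; injective⇒≤)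
open import Data.List using (List; []; _∷_; _++_; map; length; filter; allFin; lookup)
open import Data.List.Properties using (length-++; length-map; length-tabulate; filter-accept; filter-reject)
open import Data.List.Membership.Propositional using (_∈_; _∉_; find; lose)
open import Data.List.Membership.Propositional.Properties using (∈-map⁺; ∈-map⁻; ∈-filter⁻; ∈-++⁻; ∈-lookup)
open import Data.List.Relation.Unary.All using (All; []; _∷_) renaming (lookup to All-lookup; map to All-map)
open import Data.List.Relation.Unary.All.Properties using (¬Any⇒All¬)
open import Data.List.Relation.Unary.AllPairs using ([]; _∷_)
open import Data.List.Relation.Unary.Any using (Any; here; there; any?)
open import Data.List.Relation.Unary.Unique.Propositional using (Unique)
open import Data.List.Relation.Unary.Unique.Propositional.Properties using (++⁺; filter⁺; allFin⁺; Unique[x∷xs]⇒x∉xs)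
open import Data.Maybe using (just; nothing)
open import Data.Maybe.Properties using (just-injective)
open import Data.Nat using (ℕ; zero; suc; _+_; _*_; _∸_; _^_; _≤_; _<_; _⊓_; z≤n; s≤s; NonZero; >-nonZero⁻¹; _<?_)
open import Data.Nat.ListAction using (sum)
open import Data.Nat.Logarithm using (⌊log₂_⌋; ⌊log₂⌋-mono-≤; ⌊log₂[2^n]⌋≡n)
open import Data.Nat.Properties hiding (_≟_)
open import Data.Nat.Tactic.RingSolver using (solve-∀)
open import Data.Product using (∃; _×_; _,_; proj₁; proj₂)
open import Data.Sum using (_⊎_; inj₁; inj₂)
open import Function using (_∘_)
open import Relation.Binary.PropositionalEquality using (_≡_; _≢_; refl; sym; trans; cong; subst)
open import Relation.Nullary using (¬_; Dec; yes; no; ¬?; contradiction)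
open import Relation.Unary using (Decidable)

-- Duplicate-free lists, injective images and local search

private variable
  A B : Set

lookup-injective : {xs : List A} → Unique xs → ∀ i j → lookup xs i ≡ lookup xs j → i ≡ j
lookup-injective {xs = _ ∷ _} _ Fin.zero Fin.zero _ = refl
lookup-injective {xs = _ ∷ xs} u Fin.zero (Fin.suc j) eq =
  contradiction (subst (_∈ xs) (sym eq) (∈-lookup j)) (Unique[x∷xs]⇒x∉xs u)
lookup-injective {xs = _ ∷ xs} u (Fin.suc i) Fin.zero eq =
  contradiction (subst (_∈ xs) eq (∈-lookup i)) (Unique[x∷xs]⇒x∉xs u)
lookup-injective {xs = _ ∷ _} (_ ∷ u) (Fin.suc i) (Fin.suc j) eq =
  cong Fin.suc (lookup-injective u i j eq)

length-unique : ∀ {n} {xs : List (Fin n)} → Unique xs → length xs ≤ n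
length-unique u = injective⇒≤ (λ {i} {j} → lookup-injective u i j)

length-filter-¬ : {P : A → Set} (P? : Decidable P) (xs : List A) →
  length xs ≡ length (filter P? xs) + length (filter (¬? ∘ P?) xs)
length-filter-¬ P? [] = refl
length-filter-¬ P? (x ∷ xs) with P? x
... | yes _ = cong suc (length-filter-¬ P? xs)
... | no _ = trans (cong suc (length-filter-¬ P? xs)) (sym (+-suc _ _))

record Image (R : A → B → Set) (xs : List A) : Set where
  field
    list   : List B
    size   : length list ≡ length xs
    unique : Unique list
    from   : ∀ {y} → y ∈ list → ∃ λ x → x ∈ xs × R x y

-- Distinct elements share no `R`-successor, so choosing one successor for each element gives no
-- repetitions. This turns a set of matched clients or servers into equally many partners.
image : {R : A → B → Set} → (∀ {x x' y} → R x y → R x' y → x ≡ x') →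
  ∀ {xs} → Unique xs → (∀ {x} → x ∈ xs → ∃ (R x)) → Image R xs
image inj {[]} u r = record { list = [] ; size = refl ; unique = [] ; from = λ () }
image {R = R} inj {x ∷ xs} u@(_ ∷ us) r with r (here refl)
... | y , rxy = record
  { list = y ∷ list
  ; size = cong suc size
  ; unique = ¬Any⇒All¬ list y∉ ∷ unique
  ; from = from′ }
  where
  open Image (image {R = R} inj us (r ∘ there))
  y∉ : y ∉ list
  y∉ y∈ with from y∈
  ... | x' , x'∈ , rx'y = Unique[x∷xs]⇒x∉xs u (subst (_∈ xs) (inj rx'y rxy) x'∈)
  from′ : ∀ {z} → z ∈ y ∷ list → ∃ λ x' → x' ∈ x ∷ xs × R x' z
  from′ (here refl) = x , here refl , rxy
  from′ (there z∈) with from z∈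
  ... | x' , x'∈ , r' = x' , there x'∈ , r'

-- Every improvement raises `f`, which `b` bounds, so the fuel `d` with `b ≤ d + f x` cannot run out
-- before a `Good` point is met. This stands in for taking a maximiser.
climb : {Good : A → Set} (f : A → ℕ) (b : ℕ) → (∀ x → f x ≤ b) →
  (∀ x → Good x ⊎ ∃ λ y → f x < f y) → ∀ x → ∃ λ y → f x ≤ f y × Good y
climb {Good = Good} f b bound next x = go b x (m≤m+n b (f x))
  where
  go : ∀ d x → b ≤ d + f x → ∃ λ y → f x ≤ f y × Good y
  go d x h with next x
  go d x h | inj₁ g = x , ≤-refl , g
  go zero x h | inj₂ (y , lt) = contradiction (≤-trans lt (bound y)) (≤⇒≯ h)
  go (suc d) x h | inj₂ (y , lt)
    with go d y (≤-trans h (≤-trans (≤-reflexive (sym (+-suc d (f x)))) (+-monoʳ-≤ d lt)))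
  ... | z , le , g = z , ≤-trans (<⇒≤ lt) le , g

-- Exponential growth at rate (m+1)/m

bernoulli : ∀ a k → a ^ suc k + suc k * a ^ k ≤ suc a ^ suc k
bernoulli a zero = ≤-reflexive (lemma a)
  where
  lemma : ∀ a → a * 1 + 1 * 1 ≡ suc a * 1
  lemma = solve-∀
bernoulli a (suc k) = begin
  -- The added term completes the product with `suc a`; the terms kept are the first two of the
  -- binomial expansion.
  a * (a * p) + suc (suc k) * (a * p)                  ≤⟨ m≤m+n _ (suc k * p) ⟩
  a * (a * p) + suc (suc k) * (a * p) + suc k * p      ≡⟨ lemma a k p ⟩
  suc a * (a * p + suc k * p)                          ≤⟨ *-monoʳ-≤ (suc a) (bernoulli a k) ⟩
  suc a * suc a ^ suc k                                ∎
  where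
  open ≤-Reasoning
  p = a ^ k
  lemma : ∀ a k p → a * (a * p) + suc (suc k) * (a * p) + suc k * p ≡ suc a * (a * p + suc k * p)
  lemma = solve-∀

-- Both terms on the left of `bernoulli` become `m ^ m` when base and exponent agree; this is (1 +
-- 1/m)^m ≥ 2.
2m^m≤[1+m]^m : ∀ m .{{_ : NonZero m}} → 2 * m ^ m ≤ suc m ^ m
2m^m≤[1+m]^m (suc k) = ≤-trans (≤-reflexive (lemma (suc k ^ suc k))) (bernoulli (suc k) k)
  where
  lemma : ∀ p → 2 * p ≡ p + p
  lemma = solve-∀

^-distribʳ-* : ∀ l a b → (a * b) ^ l ≡ a ^ l * b ^ l
^-distribʳ-* zero a b = refl
^-distribʳ-* (suc l) a b =
  trans (cong (a * b *_) (^-distribʳ-* l a b)) (lemma a b (a ^ l) (b ^ l))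
  where
  lemma : ∀ a b p q → a * b * (p * q) ≡ a * p * (b * q)
  lemma = solve-∀

-- Every `m` rounds of growth by (m+1)/m at least double the size, so `m * l` rounds double it `l`
-- times. Denominators are cleared to stay in `ℕ`.
growth⇒2^l≤ : ∀ m l N .{{_ : NonZero m}} → suc m ^ (m * l) ≤ m ^ (m * l) * N → 2 ^ l ≤ N
growth⇒2^l≤ m l N h = *-cancelˡ-≤ (m ^ (m * l)) {{m^n≢0 m (m * l)}} (begin
  m ^ (m * l) * 2 ^ l    ≡⟨ *-comm (m ^ (m * l)) (2 ^ l) ⟩
  2 ^ l * m ^ (m * l)    ≡⟨ cong (2 ^ l *_) (^-*-assoc m m l) ⟨
  2 ^ l * (m ^ m) ^ l    ≡⟨ ^-distribʳ-* l 2 (m ^ m) ⟨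
  (2 * m ^ m) ^ l        ≤⟨ ^-monoˡ-≤ l (2m^m≤[1+m]^m m) ⟩
  (suc m ^ m) ^ l        ≡⟨ ^-*-assoc (suc m) m l ⟩
  suc m ^ (m * l)        ≤⟨ h ⟩
  m ^ (m * l) * N        ∎)
  where open ≤-Reasoning

n<2^[1+⌊log₂n⌋] : ∀ n → n < 2 ^ suc ⌊log₂ n ⌋
n<2^[1+⌊log₂n⌋] n = ≰⇒> λ h → 1+n≰n
  (≤-trans (≤-reflexive (sym (⌊log₂[2^n]⌋≡n (suc ⌊log₂ n ⌋)))) (⌊log₂⌋-mono-≤ h))

-- Matchings and alternating paths

module _ {n s : ℕ} (E : Graph n s) where

  Path : Set
  Path = List (Fin n × Fin s)

  Matched : Matching n s → Fin n → Set
  Matched M c = ∃ λ a → M a ≡ just c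

  record IsMatching (t : ℕ) (M : Matching n s) : Set where
    field
      edge      : ∀ {a c} → M a ≡ just c → E c a ≡ true
      injective : ∀ {a b c} → M a ≡ just c → M b ≡ just c → a ≡ b
      arrived   : ∀ {a c} → M a ≡ just c → toℕ c < t

  module _ {M : Matching n s} where

    alt-head : ∀ {c e P} → Alt E M c (e ∷ P) → proj₁ e ≡ c
    alt-head {P = []} alt = proj₁ alt
    alt-head {P = _ ∷ _} alt = proj₁ alt

    alt-edge : ∀ {c} P {x a} → Alt E M c P → (x , a) ∈ P → E x a ≡ true
    alt-edge (_ ∷ []) (refl , e , _) (here refl) = e
    alt-edge (_ ∷ _ ∷ _) (refl , e , _) (here refl) = e
    alt-edge (_ ∷ P@(_ ∷ _)) (_ , _ , _ , _ , alt) (there i) = alt-edge P alt i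

    -- A matched server on the path is not its last, so the next entry starts with its partner. That
    -- entry is never the first, hence `P` rather than `e ∷ P` in the conclusion.
    alt-partner : ∀ {c} e P {b y} → Alt E M c (e ∷ P) →
      b ∈ map proj₂ (e ∷ P) → M b ≡ just y → y ∈ map proj₁ P
    alt-partner e [] (_ , _ , _ , eq) (here refl) eq' with trans (sym eq) eq'
    ... | ()
    alt-partner e (_ ∷ _) (_ , _ , _ , eq , _) (here refl) eq' =
      here (just-injective (trans (sym eq') eq))
    alt-partner e (f ∷ P) (_ , _ , _ , _ , alt) (there i) eq' = there (alt-partner f P alt i eq')

    -- Every client after the first is entered through its own matching edge, from the preceding
    -- server.
    alt-client : ∀ {c} P {x a} → Alt E M c P → (x , a) ∈ P →
      x ≡ c ⊎ ∃ λ b → b ∈ map proj₂ P × M b ≡ just x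
    alt-client (_ ∷ P) alt (here refl) = inj₁ (alt-head {P = P} alt)
    alt-client (_ ∷ P@(_ ∷ _)) (_ , _ , _ , eq , alt) (there i) with alt-client P alt i
    ... | inj₁ refl = inj₂ (_ , here refl , eq)
    ... | inj₂ (b , b∈ , eq') = inj₂ (b , there b∈ , eq')

  -- The matching after an augmentation

  module Augment {t : Fin n} {M : Matching n s} (isM : IsMatching (toℕ t) M)
    {P : Path} (aug : AugPath E M t t P) where

    open IsMatching isM

    private
      M' : Matching n s
      M' = augment M P
      unmatched = proj₁ aug
      alt = proj₁ (proj₂ aug)
      clients! = proj₁ (proj₂ (proj₂ aug))
      servers! = proj₁ (proj₂ (proj₂ (proj₂ aug)))
      bounded = proj₂ (proj₂ (proj₂ (proj₂ aug)))

    augment-∈ : ∀ Q {x a} → Unique (map proj₂ Q) → (x , a) ∈ Q → augment M Q a ≡ just x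
    augment-∈ ((_ , a) ∷ Q) {a = b} u i with b ≟ a
    augment-∈ _ u (here refl) | yes _ = refl
    augment-∈ _ u (there i) | yes refl = contradiction (∈-map⁺ proj₂ i) (Unique[x∷xs]⇒x∉xs u)
    augment-∈ _ u (here refl) | no ≢ = contradiction refl ≢
    augment-∈ (_ ∷ Q) (_ ∷ u) (there i) | no _ = augment-∈ Q u i

    augment-cases : ∀ Q {x a} → augment M Q a ≡ just x →
      (x , a) ∈ Q ⊎ (a ∉ map proj₂ Q × M a ≡ just x)
    augment-cases [] eq = inj₂ ((λ ()) , eq)
    augment-cases ((_ , a) ∷ Q) {a = b} eq with b ≟ a
    augment-cases _ refl | yes refl = inj₁ (here refl)
    ... | no ≢ with augment-cases Q eq
    ...   | inj₁ i = inj₁ (there i)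
    ...   | inj₂ (∉ , eq') = inj₂ ((λ { (here p) → ≢ p ; (there i) → ∉ i }) , eq')

    unique-client : ∀ {Q : Path} {x a b} → Unique (map proj₁ Q) → (x , a) ∈ Q → (x , b) ∈ Q → a ≡ b
    unique-client u (here refl) (here refl) = refl
    unique-client u (here refl) (there j) = contradiction (∈-map⁺ proj₁ j) (Unique[x∷xs]⇒x∉xs u)
    unique-client u (there i) (here refl) = contradiction (∈-map⁺ proj₁ i) (Unique[x∷xs]⇒x∉xs u)
    unique-client (_ ∷ u) (there i) (there j) = unique-client u i j

    -- The start `t` is unmatched, and every other path client has its old partner on the path, so
    -- by injectivity no server off the path holds it. Hence old and new matching edges never clash
    -- at a client.
    on-off : ∀ {x a b} → (x , a) ∈ P → b ∉ map proj₂ P → M b ≢ just x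
    on-off i b∉ eq with alt-client P alt i
    ... | inj₁ refl = unmatched _ eq
    ... | inj₂ (b' , b'∈ , eq') = b∉ (subst (_∈ map proj₂ P) (injective eq' eq) b'∈)

    isMatching : IsMatching (suc (toℕ t)) M'
    isMatching = record { edge = edge' ; injective = injective' ; arrived = arrived' }
      where
      edge' : ∀ {a c} → M' a ≡ just c → E c a ≡ true
      edge' eq with augment-cases P eq
      ... | inj₁ i = alt-edge P alt i
      ... | inj₂ (_ , eq') = edge eq'
      injective' : ∀ {a b c} → M' a ≡ just c → M' b ≡ just c → a ≡ b
      injective' eq₁ eq₂ with augment-cases P eq₁ | augment-cases P eq₂
      ... | inj₁ i | inj₁ j = unique-client clients! i j
      ... | inj₁ i | inj₂ (∉ , eq) = contradiction eq (on-off i ∉)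
      ... | inj₂ (∉ , eq) | inj₁ j = contradiction eq (on-off j ∉)
      ... | inj₂ (_ , eq) | inj₂ (_ , eq') = injective eq eq'
      arrived' : ∀ {a c} → M' a ≡ just c → toℕ c < suc (toℕ t)
      arrived' eq with augment-cases P eq
      ... | inj₁ i = s≤s (All-lookup bounded i)
      ... | inj₂ (_ , eq') = m<n⇒m<1+n (arrived eq')

    client-matched : ∀ {x} → x ∈ map proj₁ P → Matched M' x
    client-matched x∈ with ∈-map⁻ proj₁ x∈
    ... | (_ , a) , i , refl = a , augment-∈ P servers! i

    start-matched : Matched M' t
    start-matched = client-matched (start∈ P alt)
      where
      start∈ : ∀ Q → Alt E M t Q → t ∈ map proj₁ Q
      start∈ (_ ∷ Q) alt = here (sym (alt-head {P = Q} alt))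

    -- A server off the path keeps its client. A server on the path gives its client up, but that
    -- client comes next on the path and receives a new server.
    stays-matched : ∀ {x} → Matched M x → Matched M' x
    stays-matched {x} (a , eq) with any? (a ≟_) (map proj₂ P)
    ... | yes a∈ = client-matched (partner∈ P alt a∈)
      where
      partner∈ : ∀ Q → Alt E M t Q → a ∈ map proj₂ Q → x ∈ map proj₁ Q
      partner∈ (e ∷ Q) alt a∈ = there (alt-partner e Q alt a∈ eq)
    ... | no a∉ = a , trans (off P a∉) eq
      where
      off : ∀ Q → a ∉ map proj₂ Q → augment M Q a ≡ M a
      off [] _ = refl
      off ((_ , b) ∷ Q) a∉ with a ≟ b
      ... | yes p = contradiction (here p) a∉
      ... | no _ = off Q (a∉ ∘ there)

  -- Shortcutting alternating walks

  module Shortcut {t : Fin n} {M : Matching n s} (isM : IsMatching (toℕ t) M) where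

    open IsMatching isM

    Simple : Fin n → Path → Set
    Simple c P = Alt E M c P × Unique (map proj₁ P) × Unique (map proj₂ P)
      × All (λ e → toℕ (proj₁ e) ≤ toℕ t) P

    -- Treats a walk ending at `a` and one passing through `a` alike, so that `prepend` builds the
    -- last pair and all earlier ones.
    data Continues (a : Fin s) : Path → Set where
      free : M a ≡ nothing → Continues a []
      next : ∀ {c P} → M a ≡ just c → Simple c P → Continues a P

    suffix : ∀ {c c'} P → Simple c P → c' ∈ map proj₁ P →
      ∃ λ Q → Simple c' Q × length Q ≤ length P
    suffix (e ∷ P) sim@(alt , _) (here refl) with alt-head {P = P} alt
    ... | refl = e ∷ P , sim , ≤-refl
    suffix (_ ∷ P@(_ ∷ _)) ((_ , _ , _ , _ , alt) , _ ∷ u , _ ∷ v , _ ∷ b) (there i)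
      with suffix P (alt , u , v , b) i
    ... | Q , sim , le = Q , sim , m≤n⇒m≤1+n le

    -- A walk returning to its first client is cut short there, so walks may be used as paths.
    prepend : ∀ {c a P} → toℕ c ≤ toℕ t → E c a ≡ true → Continues a P →
      ∃ λ Q → Simple c Q × length Q ≤ suc (length P)
    prepend {c} {a} c≤t ca (free eq) = (c , a) ∷ [] ,
      ((refl , ca , (λ eq' → contradiction (trans (sym eq) eq') λ ()) , eq)
      , [] ∷ [] , [] ∷ [] , c≤t ∷ []) , ≤-refl
    prepend {c} {a} {P} c≤t ca (next eq sim) with any? (c ≟_) (map proj₁ P)
    ... | yes c∈ with suffix P sim c∈
    ...   | Q , sim' , le = Q , sim' , m≤n⇒m≤1+n le
    prepend {c} {a} {e ∷ P} c≤t ca (next eq sim@(alt , u , v , b)) | no c∉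
      with alt-head {P = P} alt
    ... | refl = (c , a) ∷ e ∷ P ,
      ((refl , ca , (λ eq' → c∉ (here (just-injective (trans (sym eq') eq)))) , eq , alt)
      , ¬Any⇒All¬ _ c∉ ∷ u
      -- If `a` were already on the path, `alt-partner` would place its partner, the head client, in
      -- the tail as well.
      , ¬Any⇒All¬ _ (λ a∈ → Unique[x∷xs]⇒x∉xs u (alt-partner e P alt a∈ eq)) ∷ v
      , c≤t ∷ b) , ≤-refl

  -- Separated pairs and Hall's condition

  -- The clients are K and the servers avoid N(K), so that the value below, at best
  -- m s + (m+1)|K| − m|N(K)|, involves no subtraction.
  record Separated (M : Matching n s) : Set where
    constructor separated
    field
      clients   : List (Fin n)
      servers   : List (Fin s)
      clients!  : Unique clients
      servers!  : Unique servers
      matched   : ∀ {c} → c ∈ clients → Matched M c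
      separate  : ∀ {c a} → c ∈ clients → a ∈ servers → E c a ≢ true

  open Separated

  value : ℕ → ∀ {M} → Separated M → ℕ
  value m S = suc m * length (clients S) + m * length (servers S)

  transport : ∀ {M M'} → (∀ {c} → Matched M c → Matched M' c) → Separated M → Separated M'
  transport f S = separated (clients S) (servers S) (clients! S) (servers! S) (f ∘ matched S) (separate S)

  -- The partners of K are |K| servers, none of them listed in `servers S` because a matching edge
  -- is an edge of `E`. So `k + x ≤ s`, which is Hall's condition for K.
  value-bound : ∀ {t M} → IsMatching t M → ∀ m (S : Separated M) → value m S ≤ n + m * s
  value-bound {M = M} isM m S = begin
    suc m * k + m * x   ≡⟨ lemma m k x ⟩
    k + m * (k + x)     ≤⟨ +-mono-≤ (length-unique (clients! S)) (*-monoʳ-≤ m k+x≤s) ⟩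
    n + m * s           ∎
    where
    open ≤-Reasoning
    open IsMatching isM using (edge)
    k = length (clients S)
    x = length (servers S)
    lemma : ∀ m k x → suc m * k + m * x ≡ k + m * (k + x)
    lemma = solve-∀
    partners : Image (λ c a → M a ≡ just c) (clients S)
    partners = image (λ p q → just-injective (trans (sym p) q)) (clients! S) (matched S)
    disjoint : ∀ {a} → a ∈ Image.list partners × a ∈ servers S → ⊥
    disjoint (i , j) with Image.from partners i
    ... | c , c∈ , eq = separate S c∈ j (edge eq)
    k+x≤s : k + x ≤ s
    k+x≤s = begin
      k + x                                      ≡⟨ cong (_+ x) (Image.size partners) ⟨
      length (Image.list partners) + x           ≡⟨ length-++ (Image.list partners) ⟨
      length (Image.list partners ++ servers S)  ≤⟨ length-unique (++⁺ (Image.unique partners) (servers! S) disjoint) ⟩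
      s                                          ∎

  -- Expanding layers and the admission of the new client

  module Potential {t : Fin n} {M : Matching n s} (isM : IsMatching (toℕ t) M) where

    open IsMatching isM
    open Shortcut isM

    module Expansion (S : Separated M) {a₀ : Fin s} (a₀∈ : a₀ ∈ servers S) (ta₀ : E t a₀ ≡ true) where

      -- A double move of an alternating walk, read from `a` to `b`: the matching edge at `a`, then
      -- any edge. The second edge may be the matching edge again, so layers may overlap.
      Step : Fin s → Fin s → Set
      Step b a = ∃ λ c → M a ≡ just c × E c b ≡ true

      step? : ∀ b a → Dec (Step b a)
      step? b a with M a
      ... | nothing = no λ { (_ , () , _) }
      ... | just c with E c b Bool.≟ true
      ...   | yes e = yes (c , refl , e)
      ...   | no ¬e = no λ { (_ , refl , e) → ¬e e }

      reached? : ∀ T → Decidable (λ b → Any (Step b) T)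
      reached? T b = any? (step? b) T

      layer : ℕ → List (Fin s)
      layer zero    = a₀ ∷ []
      layer (suc i) = filter (reached? (layer i)) (servers S)

      layer! : ∀ i → Unique (layer i)
      layer! zero    = [] ∷ []
      layer! (suc i) = filter⁺ (reached? (layer i)) (servers! S)

      layer⊆ : ∀ i {a} → a ∈ layer i → a ∈ servers S
      layer⊆ zero (here refl) = a₀∈
      layer⊆ (suc i) a∈ = proj₁ (∈-filter⁻ (reached? (layer i)) a∈)

      -- The walk is extended backwards one layer at a time until it starts at `t`. Each layer costs
      -- at most one pair, and `prepend` removes repetitions.
      path : ∀ i {a P} → a ∈ layer i → Continues a P →
        ∃ λ Q → Simple t Q × length Q ≤ suc i + length P
      path zero (here refl) cont = prepend ≤-refl ta₀ cont
      path (suc i) {P = P} a∈ cont with find (proj₂ (∈-filter⁻ (reached? (layer i)) {xs = servers S} a∈))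
      ... | b , b∈ , c , eq , ca with prepend (<⇒≤ (arrived eq)) ca cont
      ...   | Q , sim , le with path i b∈ (next eq sim)
      ...     | Q' , sim' , le' = Q' , sim' ,
        ≤-trans le' (≤-trans (+-monoʳ-≤ (suc i) le) (≤-reflexive (+-suc (suc i) (length P))))

      module _ {len : ℕ} (shortest : ∀ Q → AugPath E M t t Q → len ≤ length Q) where

        -- A free server in layer `i` would end an augmenting path from `t` of at most `i + 1`
        -- pairs, shorter than the shortest one.
        layer-matched : ∀ i → suc i < len → ∀ {a} → a ∈ layer i → ∃ λ c → M a ≡ just c
        layer-matched i i<len {a} a∈ with M a in eq
        ... | just c = c , refl
        ... | nothing with path i a∈ (free eq)
        ...   | Q , sim , le = contradiction
          (≤-trans (shortest Q ((λ _ eq' → <-irrefl refl (arrived eq')) , sim))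
            (≤-trans le (≤-reflexive (+-identityʳ (suc i)))))
          (<⇒≱ i<len)

        partners : ∀ i → suc i < len → Image (λ a c → M a ≡ just c) (layer i)
        partners i i<len = image injective (layer! i) (layer-matched i i<len)

        -- Layers of an optimal pair must grow by the factor (m+1)/m: otherwise
        -- trade the layer's partners against the servers they reach.
        grow : ∀ m i → suc i < len →
          suc m * length (layer i) ≤ m * length (layer (suc i)) ⊎ ∃ λ (S' : Separated M) → value m S < value m S'
        grow m i i<len with m * length (layer (suc i)) <? suc m * length (layer i)
        ... | no ≮ = inj₁ (≮⇒≥ ≮)
        ... | yes lt = inj₂ (S' , (begin-strict
          suc m * k + m * length (servers S)  ≡⟨ cong (λ z → suc m * k + m * z) (length-filter-¬ R? (servers S)) ⟩
          suc m * k + m * (length (layer (suc i)) + x') ≡⟨ lemma₁ m k _ x' ⟩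
          m * length (layer (suc i)) + (suc m * k + m * x') <⟨ +-monoˡ-< _ lt ⟩
          suc m * length (layer i) + (suc m * k + m * x') ≡⟨ lemma₂ m k _ x' ⟩
          suc m * (length (layer i) + k) + m * x' ≡⟨ cong (λ z → suc m * z + m * x') (cong (_+ k) (Image.size I)) ⟨
          suc m * (length (Image.list I) + k) + m * x' ≡⟨ cong (λ z → suc m * z + m * x') (length-++ (Image.list I)) ⟨
          value m S' ∎))
          where
          open ≤-Reasoning
          R? = reached? (layer i)
          I = partners i i<len
          k = length (clients S)
          x' = length (filter (¬? ∘ R?) (servers S))
          lemma₁ : ∀ m k a x → suc m * k + m * (a + x) ≡ m * a + (suc m * k + m * x)
          lemma₁ = solve-∀
          lemma₂ : ∀ m k a x → suc m * a + (suc m * k + m * x) ≡ suc m * (a + k) + m * x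
          lemma₂ = solve-∀
          -- A partner already in K would be joined by its matching edge to a server of the layer,
          -- which `separate` forbids.
          disjoint : ∀ {c} → c ∈ Image.list I × c ∈ clients S → ⊥
          disjoint (j , c∈) with Image.from I j
          ... | a , a∈ , eq = separate S c∈ (layer⊆ i a∈) (edge eq)
          matched' : ∀ {c} → c ∈ Image.list I ++ clients S → Matched M c
          matched' c∈ with ∈-++⁻ (Image.list I) c∈
          ... | inj₂ j = matched S j
          ... | inj₁ j with Image.from I j
          ...   | a , _ , eq = a , eq
          separate' : ∀ {c a} → c ∈ Image.list I ++ clients S → a ∈ filter (¬? ∘ R?) (servers S) → E c a ≢ true
          separate' c∈ a∈ e with ∈-++⁻ (Image.list I) c∈ | ∈-filter⁻ (¬? ∘ R?) {xs = servers S} a∈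
          ... | inj₂ j | a∈' , _ = separate S j a∈' e
          ... | inj₁ j | _ , ¬R with Image.from I j
          ...   | b , b∈ , eq = ¬R (lose b∈ (_ , eq , e))
          S' : Separated M
          S' = separated (Image.list I ++ clients S) (filter (¬? ∘ R?) (servers S))
            (++⁺ (Image.unique I) (clients! S) disjoint) (filter⁺ (¬? ∘ R?) (servers! S)) matched' separate'

        -- Chains the layer ratios, with denominators cleared, from the single server of layer 0.
        -- The first layer that fails to grow supplies the better pair.
        grow^ : ∀ m i → suc i < len →
          suc m ^ i ≤ m ^ i * length (layer i) ⊎ ∃ λ (S' : Separated M) → value m S < value m S'
        grow^ m zero _ = inj₁ ≤-refl
        grow^ m (suc i) i<len with grow^ m i (<⇒≤ i<len) | grow m i (<⇒≤ i<len)
        ... | inj₂ better | _ = inj₂ better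
        ... | inj₁ _ | inj₂ better = inj₂ better
        ... | inj₁ h | inj₁ h' = inj₁ (begin
          suc m * suc m ^ i                       ≤⟨ *-monoʳ-≤ (suc m) h ⟩
          suc m * (m ^ i * length (layer i))      ≡⟨ lemma₁ (suc m) (m ^ i) _ ⟩
          m ^ i * (suc m * length (layer i))      ≤⟨ *-monoʳ-≤ (m ^ i) h' ⟩
          m ^ i * (m * length (layer (suc i)))    ≡⟨ lemma₂ (m ^ i) m _ ⟩
          m * m ^ i * length (layer (suc i))      ∎)
          where
          open ≤-Reasoning
          lemma₁ : ∀ a b c → a * (b * c) ≡ b * (a * c)
          lemma₁ = solve-∀
          lemma₂ : ∀ a b c → a * (b * c) ≡ b * a * c
          lemma₂ = solve-∀

        -- If every round grew, layer `m * l` would hold at least `2 ^ l` servers, more than `n`;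
        -- yet these are matched to distinct clients, since the path is too long for a free server
        -- to occur there.
        improve : ∀ m l .{{_ : NonZero m}} → n < 2 ^ l → suc (m * l) < len →
          ∃ λ (S' : Separated M) → value m S < value m S'
        improve m l n<2^l long with grow^ m (m * l) long
        ... | inj₂ better = better
        ... | inj₁ h = contradiction (growth⇒2^l≤ m l n (≤-trans h (*-monoʳ-≤ (m ^ (m * l)) layer≤n))) (<⇒≱ n<2^l)
          where
          I = partners (m * l) long
          layer≤n : length (layer (m * l)) ≤ n
          layer≤n = ≤-trans (≤-reflexive (sym (Image.size I))) (length-unique (Image.unique I))

    Good : Separated M → Set
    Good S = ¬ Any (λ a → E t a ≡ true) (servers S)

    module _ (m l : ℕ) .{{_ : NonZero m}} (n<2^l : n < 2 ^ l) (P : Path) (aug : AugPath E M t t P)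
      (shortest : ∀ Q → AugPath E M t t Q → length P ≤ length Q) (long : suc (m * l) < length P) where

      good-or-improve : (S : Separated M) → Good S ⊎ ∃ λ (S' : Separated M) → value m S < value m S'
      good-or-improve S with any? (λ a → E t a Bool.≟ true) (servers S)
      ... | no none = inj₁ none
      ... | yes some with find some
      ...   | a , a∈ , ta = inj₂ (Expansion.improve S a∈ ta shortest m l n<2^l long)

      -- Once climbing reaches a pair whose servers include no neighbour of `t`, the client `t`
      -- joins K with no server dropped. It is new to K because it was unmatched before.
      admit : ∀ {M'} → (∀ {c} → Matched M c → Matched M' c) → Matched M' t →
        (S : Separated M) → ∃ λ (S' : Separated M') → suc m + value m S ≤ value m S'
      admit mono t-matched S₀
        with climb {Good = Good} (value m) (n + m * s) (value-bound isM m) good-or-improve S₀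
      ... | S , le , good = separated (t ∷ clients S) (servers S)
          (¬Any⇒All¬ _ t∉ ∷ clients! S) (servers! S) matched' separate'
        , ≤-trans (+-monoʳ-≤ (suc m) le) (≤-reflexive (lemma m (length (clients S)) (length (servers S))))
        where
        lemma : ∀ m k x → suc m + (suc m * k + m * x) ≡ suc m * suc k + m * x
        lemma = solve-∀
        t∉ : t ∉ clients S
        t∉ t∈K with matched S t∈K
        ... | a , eq = proj₁ aug a eq
        matched' : ∀ {c} → c ∈ t ∷ clients S → Matched _ c
        matched' (here refl) = t-matched
        matched' (there c∈) = mono (matched S c∈)
        separate' : ∀ {c a} → c ∈ t ∷ clients S → a ∈ servers S → E c a ≢ true
        separate' (here refl) a∈ e = good (lose a∈ e)
        separate' (there c∈) = separate S c∈

  -- Invariants of a run and its path lengths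

  relabel : ∀ {t M M'} → (∀ a → M' a ≡ M a) → IsMatching t M → IsMatching t M'
  relabel {M = M} {M'} eq isM = record
    { edge = λ p → edge (to p)
    ; injective = λ p q → injective (to p) (to q)
    ; arrived = λ p → arrived (to p) }
    where
    open IsMatching isM
    to : ∀ {a c} → M' a ≡ just c → M a ≡ just c
    to {a} p = trans (sym (eq a)) p

  matched-≗ : ∀ {M M'} → (∀ a → M' a ≡ M a) → ∀ {c} → Matched M c → Matched M' c
  matched-≗ eq (a , p) = a , trans (eq a) p

  at : ∀ {t M} (t<n : t < n) → IsMatching t M → IsMatching (toℕ (fromℕ< t<n)) M
  at t<n = subst (λ i → IsMatching i _) (sym (toℕ-fromℕ< t<n))

  run-matching : ∀ {t M k} → SAPRun E t M k → IsMatching t M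
  run-matching start = record { edge = λ () ; injective = λ () ; arrived = λ () }
  run-matching (step r t<n (inj₁ (_ , eq , _))) = record
    { edge = edge ; injective = injective ; arrived = λ p → m<n⇒m<1+n (arrived p) }
    where open IsMatching (relabel eq (run-matching r))
  run-matching (step r t<n (inj₂ (P , aug , _ , eq , _))) =
    relabel eq (subst (λ i → IsMatching (suc i) _) (toℕ-fromℕ< t<n)
      (Augment.isMatching (at t<n (run-matching r)) aug))

  -- Lengths count client-server pairs rather than edges, and only for steps that augment; `p` pairs
  -- cost 2p - 1 replacements.
  lengths : ∀ {t M k} → SAPRun E t M k → List ℕ
  lengths start = []
  lengths (step r _ (inj₁ _)) = lengths r
  lengths (step r _ (inj₂ (P , _))) = length P ∷ lengths r

  length-lengths : ∀ {t M k} (r : SAPRun E t M k) → length (lengths r) ≤ t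
  length-lengths start = z≤n
  length-lengths (step r _ (inj₁ _)) = m≤n⇒m≤1+n (length-lengths r)
  length-lengths (step r _ (inj₂ _)) = s≤s (length-lengths r)

  -- The clients on a simple path are distinct, one per pair.
  lengths≤n : ∀ {t M k} (r : SAPRun E t M k) → All (_≤ n) (lengths r)
  lengths≤n start = []
  lengths≤n (step r _ (inj₁ _)) = lengths≤n r
  lengths≤n (step r _ (inj₂ (P , (_ , _ , u , _) , _))) =
    ≤-trans (≤-reflexive (sym (length-map proj₁ P))) (length-unique u) ∷ lengths≤n r

  replacements≤ : ∀ {t M k} (r : SAPRun E t M k) → k ≤ 2 * sum (lengths r)
  replacements≤ start = z≤n
  replacements≤ (step {k = k} r _ (inj₁ (_ , _ , refl))) =
    ≤-trans (≤-reflexive (+-identityʳ k)) (replacements≤ r)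
  replacements≤ (step {k = k} r _ (inj₂ (P , _ , _ , _ , refl))) = begin
    k + (2 * length P ∸ 1)                ≤⟨ +-mono-≤ (replacements≤ r) (m∸n≤m (2 * length P) 1) ⟩
    2 * sum (lengths r) + 2 * length P    ≡⟨ lemma (sum (lengths r)) (length P) ⟩
    2 * (length P + sum (lengths r))      ∎
    where
    open ≤-Reasoning
    lemma : ∀ a b → 2 * a + 2 * b ≡ 2 * (b + a)
    lemma = solve-∀

  -- Counting long augmenting paths

  module _ (m l : ℕ) .{{_ : NonZero m}} (n<2^l : n < 2 ^ l) where

    private
      count : List ℕ → ℕ
      count ls = length (filter (m * suc l <?_) ls)

      -- Taking a multiple of `m` as threshold makes it double with `m`, as the dyadic sum requires;
      -- `1 ≤ m` absorbs the additive one.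
      long⇒ : ∀ {k} → m * suc l < k → suc (m * l) < k
      long⇒ = ≤-trans (s≤s (≤-trans (+-monoˡ-≤ (m * l) (>-nonZero⁻¹ m)) (≤-reflexive (sym (*-suc m l)))))

    -- The baseline `m * s` is the value with K empty and all servers listed; each long path must
    -- add `m + 1` to it.
    Large : Matching n s → List ℕ → Set
    Large M ls = ∃ λ (S : Separated M) → m * s + suc m * count ls ≤ value m S

    advance : ∀ {t M M'} → IsMatching (toℕ t) M → ∀ P → AugPath E M t t P →
      (∀ Q → AugPath E M t t Q → length P ≤ length Q) → (∀ a → M' a ≡ augment M P a) →
      ∀ ls → Large M ls → Large M' (length P ∷ ls)
    advance {M = M} {M'} isM P aug shortest eq ls (S , le) = go (m * suc l <? length P)
      where
      mono : ∀ {c} → Matched M c → Matched M' c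
      mono x = matched-≗ eq (Augment.stays-matched isM aug x)
      admitted : m * suc l < length P → ∃ λ (S' : Separated M') → suc m + value m S ≤ value m S'
      admitted long = Potential.admit isM m l n<2^l P aug shortest (long⇒ long) mono
        (matched-≗ eq (Augment.start-matched isM aug)) S
      lemma : ∀ m s c → m * s + suc m * suc c ≡ suc m + (m * s + suc m * c)
      lemma = solve-∀
      go : Dec (m * suc l < length P) → Large M' (length P ∷ ls)
      go (no short) = transport mono S ,
        ≤-trans (≤-reflexive (cong (λ xs → m * s + suc m * length xs) (filter-reject (m * suc l <?_) {xs = ls} short))) le
      go (yes long) = proj₁ (admitted long) , (begin
        m * s + suc m * count (length P ∷ ls)   ≡⟨ cong (λ xs → m * s + suc m * length xs) (filter-accept (m * suc l <?_) {xs = ls} long) ⟩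
        m * s + suc m * suc (count ls)          ≡⟨ lemma m s (count ls) ⟩
        suc m + (m * s + suc m * count ls)      ≤⟨ +-monoʳ-≤ (suc m) le ⟩
        suc m + value m S                       ≤⟨ proj₂ (admitted long) ⟩
        value m (proj₁ (admitted long))         ∎)
        where open ≤-Reasoning

    potential : ∀ {t M k} (r : SAPRun E t M k) → Large M (lengths r)
    potential start = separated [] (allFin s) [] (allFin⁺ s) (λ ()) (λ ()) ,
      ≤-reflexive (trans (+-comm (m * s) (suc m * 0))
        (cong (λ z → suc m * 0 + m * z) (sym (length-tabulate {n = s} (λ i → i)))))
    potential (step r _ (inj₁ (_ , eq , _))) =
      transport (matched-≗ eq) (proj₁ (potential r)) , proj₂ (potential r)
    potential (step r t<n (inj₂ (P , aug , shortest , eq , _))) =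
      advance (at t<n (run-matching r)) P aug shortest eq (lengths r) (potential r)

    -- The baseline `m * s` cancels against the same term in `value-bound`, leaving `n` as a bound
    -- on `suc m` times the count.
    few-long : ∀ {M k} (r : SAPRun E n M k) → m * count (lengths r) ≤ n
    few-long r with potential r
    ... | S , le = ≤-trans (*-monoˡ-≤ (count (lengths r)) (n≤1+n m)) (+-cancelˡ-≤ (m * s) _ _
      (≤-trans le (≤-trans (value-bound (run-matching r) m S) (≤-reflexive (+-comm n (m * s))))))

-- Dyadic summation of capped lengths

sum-⊓-double : ∀ b ls →
  sum (map (2 * b ⊓_) ls) ≤ sum (map (b ⊓_) ls) + b * length (filter (b <?_) ls)
sum-⊓-double b [] = z≤n
sum-⊓-double b (x ∷ ls) with b <? x
... | yes b<x rewrite filter-accept (b <?_) {xs = ls} b<x = begin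
  -- This entry exceeds `b`: its capped value rises from `b` to at most `2 * b`, and its unit in the
  -- count pays for the extra `b`.
  2 * b ⊓ x + sum (map (2 * b ⊓_) ls)   ≤⟨ +-mono-≤ (m⊓n≤m (2 * b) x) (sum-⊓-double b ls) ⟩
  2 * b + (r + b * c)                   ≡⟨ lemma b r c ⟩
  b + r + b * suc c                     ≡⟨ cong (λ z → z + r + b * suc c) (m≤n⇒m⊓n≡m (<⇒≤ b<x)) ⟨
  b ⊓ x + r + b * suc c                 ∎
  where
  open ≤-Reasoning
  r = sum (map (b ⊓_) ls)
  c = length (filter (b <?_) ls)
  lemma : ∀ b r c → 2 * b + (r + b * c) ≡ b + r + b * suc c
  lemma = solve-∀
... | no b≮x rewrite filter-reject (b <?_) {xs = ls} b≮x = begin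
  2 * b ⊓ x + sum (map (2 * b ⊓_) ls)   ≤⟨ +-mono-≤ (m⊓n≤n (2 * b) x) (sum-⊓-double b ls) ⟩
  x + (r + b * c)                       ≡⟨ +-assoc x r (b * c) ⟨
  x + r + b * c                         ≡⟨ cong (λ z → z + r + b * c) (m≥n⇒m⊓n≡n (≮⇒≥ b≮x)) ⟨
  b ⊓ x + r + b * c                     ∎
  where
  open ≤-Reasoning
  r = sum (map (b ⊓_) ls)
  c = length (filter (b <?_) ls)

sum-⊓≤ : ∀ L ls → sum (map (L ⊓_) ls) ≤ L * length ls
sum-⊓≤ L [] = z≤n
sum-⊓≤ L (x ∷ ls) = ≤-trans (+-mono-≤ (m⊓n≤m L x) (sum-⊓≤ L ls)) (≤-reflexive (sym (*-suc L (length ls))))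

sum-⊓-absorb : ∀ {b ls} → All (_≤ b) ls → sum (map (b ⊓_) ls) ≡ sum ls
sum-⊓-absorb [] = refl
sum-⊓-absorb {b} {x ∷ ls} (x≤b ∷ h) rewrite m≥n⇒m⊓n≡n x≤b = cong (x +_) (sum-⊓-absorb h)

-- Summing over the dyadic scales 2^j L: the entries exceeding 2^j L contribute at most L N at scale j.
sum-dyadic : ∀ L N ls → (∀ j → 2 ^ j * length (filter (2 ^ j * L <?_) ls) ≤ N) →
  ∀ J → sum (map (2 ^ J * L ⊓_) ls) ≤ L * length ls + J * (L * N)
sum-dyadic L N ls few zero rewrite +-identityʳ L | +-identityʳ (L * length ls) = sum-⊓≤ L ls
sum-dyadic L N ls few (suc J) rewrite *-assoc 2 (2 ^ J) L = begin
  sum (map (2 * b ⊓_) ls)                    ≤⟨ sum-⊓-double b ls ⟩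
  sum (map (b ⊓_) ls) + b * c                ≤⟨ +-mono-≤ (sum-dyadic L N ls few J) bc≤LN ⟩
  L * length ls + J * (L * N) + L * N        ≡⟨ lemma (L * length ls) J (L * N) ⟩
  L * length ls + suc J * (L * N)            ∎
  where
  open ≤-Reasoning
  b = 2 ^ J * L
  c = length (filter (b <?_) ls)
  lemma : ∀ x J y → x + J * y + y ≡ x + suc J * y
  lemma = solve-∀
  lemma′ : ∀ p L c → p * L * c ≡ L * (p * c)
  lemma′ = solve-∀
  bc≤LN : b * c ≤ L * N
  bc≤LN = ≤-trans (≤-reflexive (lemma′ (2 ^ J) L c)) (*-monoʳ-≤ L (few J))

-- Assembling the bound

theorem1 : ∃ λ (C : ℕ) → ∀ (n s : ℕ) → 2 ≤ n → (E : Graph n s)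
    → (M : Matching n s) (k : ℕ) → SAPRun E n M k
    → k ≤ C * n * (⌊log₂ n ⌋ ^ 2)
-- The constant is `2 * 3 ^ 2`: a factor 2 from edges per pair, and the square of the 3 in
-- `L ≤ 3 * lg`.
theorem1 = 18 , λ n s 2≤n E M k r → bound n s 2≤n E r
  where
  open ≤-Reasoning
  bound : ∀ n s → 2 ≤ n → (E : Graph n s) → ∀ {M k} → SAPRun E n M k → k ≤ 18 * n * (⌊log₂ n ⌋ ^ 2)
  bound n s 2≤n E {k = k} r = begin
    k                                       ≤⟨ replacements≤ E r ⟩
    -- After `l` doublings the cap `2 ^ l * L` is at least `n`, hence at least every path length, so
    -- capping loses nothing.
    2 * sum ls                              ≡⟨ cong (2 *_) (sum-⊓-absorb (All-map (λ h → ≤-trans h n≤b) (lengths≤n E r))) ⟨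
    2 * sum (map (2 ^ l * L ⊓_) ls)         ≤⟨ *-monoʳ-≤ 2 (sum-dyadic L n ls few l) ⟩
    2 * (L * length ls + l * (L * n))       ≤⟨ *-monoʳ-≤ 2 (+-monoˡ-≤ _ (*-monoʳ-≤ L (length-lengths E r))) ⟩
    -- The base level and each of the `l` scales contribute `L * n`, in all `suc l = L` times.
    2 * (L * n + l * (L * n))               ≡⟨ collect L l n ⟩
    2 * n * (L * L)                         ≤⟨ *-monoʳ-≤ (2 * n) (*-mono-≤ L≤3lg L≤3lg) ⟩
    2 * n * (3 * lg * (3 * lg))             ≡⟨ expand n lg ⟩
    18 * n * (lg ^ 2)                       ∎
    where
    lg = ⌊log₂ n ⌋
    l  = suc lg
    L  = suc l
    ls = lengths E r
    few : ∀ j → 2 ^ j * length (filter (2 ^ j * L <?_) ls) ≤ n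
    few j = few-long E (2 ^ j) l {{m^n≢0 2 j}} (n<2^[1+⌊log₂n⌋] n) r
    n≤b : n ≤ 2 ^ l * L
    n≤b = ≤-trans (<⇒≤ (n<2^[1+⌊log₂n⌋] n)) (m≤m*n (2 ^ l) L)
    L≤3lg : L ≤ 3 * lg
    -- From `2 ≤ n` the logarithm is at least 1, so the 2 in `L = 2 + lg` is at most `2 * lg`.
    L≤3lg = ≤-trans (+-monoˡ-≤ lg (*-monoʳ-≤ 2 (⌊log₂⌋-mono-≤ 2≤n))) (≤-reflexive (triple lg))
      where
      triple : ∀ x → 2 * x + x ≡ 3 * x
      triple = solve-∀
    collect : ∀ L l n → 2 * (L * n + l * (L * n)) ≡ 2 * n * (L * suc l)
    collect = solve-∀
    expand : ∀ n x → 2 * n * (3 * x * (3 * x)) ≡ 18 * n * (x * (x * 1))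
    expand = solve-∀
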